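{- Let $j\ge 1$ and $n\ge \sigma_j$ be two integers. Define the integer $r\ge 0$ by $$\sigma_{j+r}-\sigma_r\le n<\sigma_{j+r+1}-\sigma_{r+1}$$ and $n'$ by $$0\le n'=n-(\sigma_{j+r}-\sigma_r)<p_{j+r+1}-p_{r+1}.$$ Then $$h_j(n)\le p_{r+1}p_{r+2}\cdots p_{r+j}\,\frac{p_{j+r+1}}{p_{j+r+1}-n'}=\frac{N_{j+r+1}}{N_r\,(p_{j+r+1}-n')}.$$
   Context: Let $p_i$ denote the $i$-th prime ($p_1=2$). Set $\sigma_0=0$, $N_0=1$, and for $j\ge1$, $\sigma_j=p_1+\dots+p_j$ and $N_j=p_1p_2\cdots p_j$. For a squarefree positive integer $M$, $\ell(M)$ denotes the sum of the prime factors of $M$ (with $\ell(1)=0$) and $\omega(M)$ the number of prime factors of $M$. For integers $j\ge0$ and $n\ge\sigma_j$, $h_j(n)$ is the maximum of all squarefree positive integers $M$ with $\omega(M)=j$ and $\ell(M)\le n$. -}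

module Defs where

open import Data.List.Base using (List; []; _∷_; length)
open import Data.List.Relation.Binary.Permutation.Propositional.Properties using (↭-length)
open import Data.List.Relation.Unary.All using (All; []; _∷_)
open import Data.Nat.Base
open import Data.Nat.Divisibility
open import Data.Nat.Induction using (<-rec)
open import Data.Nat.ListAction using (sum; product)
open import Data.Nat.ListAction.Properties using (sum-↭)
open import Data.Nat.Primality
open import Data.Nat.Primality.Factorisation
open import Data.Nat.Properties
open import Data.Product.Base using (∃; _×_; _,_; proj₁; proj₂)
open import Data.Sum.Base using (inj₁; inj₂)
open import Relation.Binary.PropositionalEquality
open import Relation.Nullary.Decidable using (Dec; yes; no; map′; _×-dec_; _→-dec_)
open import Relation.Nullary.Negation using (¬_; contradiction)
open import Relation.Unary using (Decidable)

open PrimeFactorisation using (isFactorisation; factorsPrime)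

IsMinimum : (ℕ → Set) → ℕ → Set
IsMinimum P m = P m × (∀ {k} → P k → m ≤ k)

IsMaximum : (ℕ → Set) → ℕ → Set
IsMaximum P m = P m × (∀ {k} → P k → k ≤ m)

minimum : ∀ {P} → Decidable P → ∃ P → ∃ (IsMinimum P)
minimum {P} P? (w , Pw) = <-rec (λ n → P n → ∃ (IsMinimum P)) step w Pw
  where
  step : ∀ n → (∀ {k} → k < n → P k → ∃ (IsMinimum P)) → P n → ∃ (IsMinimum P)
  step n rec Pn with anyUpTo? P? n
  ... | yes (k , k<n , Pk) = rec k<n Pk
  ... | no  none           = n , Pn , λ {k} Pk → ≮⇒≥ λ k<n → none (k , k<n , Pk)

maximum : ∀ {P} → Decidable P → ∀ b → (∀ {k} → P k → k ≤ b) → ∃ P → ∃ (IsMaximum P)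
maximum P? b bound w with P? b
... | yes Pb = b , Pb , bound
maximum {P} P? zero    bound (k , Pk) | no ¬P0 =
  contradiction (subst P (n≤0⇒n≡0 (bound Pk)) Pk) ¬P0
maximum     P? (suc b) bound w        | no ¬Pb =
  maximum P? b (λ Pk → s≤s⁻¹ (≤∧≢⇒< (bound Pk) λ { refl → ¬Pb Pk })) w

prime-beyond : ∀ n → ∃ λ q → Prime q × n < q
prime-beyond n = go (factorise (suc (n !)))
  where
  go : PrimeFactorisation (suc (n !)) → ∃ λ q → Prime q × n < q
  go record { factors = [] ; isFactorisation = eq } =
    contradiction (suc-injective eq) (≢-nonZero⁻¹ (n !) {{n !≢0}})
  go record { factors = q ∷ qs ; isFactorisation = eq ; factorsPrime = pq ∷ _ } =
    q , pq , ≰⇒> λ q≤n →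
      contradiction
        (subst Prime (∣1⇒≡1 (∣m+n∣m⇒∣n q∣n!+1 (q∣n! q≤n))) pq) ¬prime[1]
    where
    q∣n!+1 : q ∣ n ! + 1
    q∣n!+1 = subst (q ∣_) (trans (sym eq) (+-comm 1 (n !))) (m∣m*n (product qs))

    q∣q! : ∀ {q} → Prime q → q ∣ q !
    q∣q! {zero}  p = contradiction p ¬prime[0]
    q∣q! {suc q} _ = m∣m*n (q !)

    q∣n! : q ≤ n → q ∣ n !
    q∣n! q≤n = ∣-trans (q∣q! pq) (m≤n⇒m!∣n! q≤n)

nextPrime : ∀ n → ∃ (IsMinimum λ q → Prime q × n < q)
nextPrime n = minimum (λ q → prime? q ×-dec (n <? q)) (prime-beyond n)

-- The primes are indexed from 1, so p 1 = 2; the value p 0 = 0 only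
-- starts the recursion.
p : ℕ → ℕ
p zero    = 0
p (suc i) = proj₁ (nextPrime (p i))

p-prime : ∀ i → Prime (p (suc i))
p-prime i = proj₁ (proj₁ (proj₂ (nextPrime (p i))))

p-< : ∀ i → p i < p (suc i)
p-< i = proj₂ (proj₁ (proj₂ (nextPrime (p i))))

σ : ℕ → ℕ
σ zero    = 0
σ (suc j) = σ j + p (suc j)

N : ℕ → ℕ
N zero    = 1
N (suc j) = N j * p (suc j)

-- ∏p r j = p_{r+1} p_{r+2} ⋯ p_{r+j}
∏p : ℕ → ℕ → ℕ
∏p r zero    = 1
∏p r (suc j) = ∏p r j * p (r + suc j)

N-nonZero : ∀ j → NonZero (N j)
N-nonZero zero    = _
N-nonZero (suc j) =
  m*n≢0 (N j) (p (suc j)) {{N-nonZero j}} {{prime⇒nonZero (p-prime j)}}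

Squarefree : ℕ → Set
Squarefree m = ∀ d → d * d ∣ m → d ≡ 1

-- Prime factors are listed with multiplicity by factorise; on squarefree
-- numbers, where alone ℓ and ω are used, every multiplicity is 1.
ℓ : ∀ m → .{{NonZero m}} → ℕ
ℓ m = sum (factors (factorise m))

ω : ∀ m → .{{NonZero m}} → ℕ
ω m = length (factors (factorise m))

record Admissible (j n m : ℕ) : Set where
  constructor admissible
  field
    {{m≢0}}    : NonZero m
    squarefree : Squarefree m
    ω≡j        : ω m ≡ j
    ℓ≤n        : ℓ m ≤ n

squarefree? : ∀ m → .{{NonZero m}} → Dec (Squarefree m)
squarefree? m =
  map′ (λ f d d²∣m → f (s≤s (d≤m d d²∣m)) d²∣m) (λ sf {d} _ → sf d)
    (allUpTo? (λ d → (d * d ∣? m) →-dec (d ≟ 1)) (suc m))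
  where
  d≤m : ∀ d → d * d ∣ m → d ≤ m
  d≤m zero    _    = z≤n
  d≤m (suc d) d²∣m = ≤-trans (m≤m*n (suc d) (suc d)) (∣⇒≤ d²∣m)

admissible? : ∀ j n → Decidable (Admissible j n)
admissible? j n zero        = no λ a → ≢-nonZero⁻¹ 0 {{Admissible.m≢0 a}} refl
admissible? j n m@(suc _) =
  map′ (λ (sf , eq , le) → admissible sf eq le)
       (λ (admissible sf eq le) → sf , eq , le)
       (squarefree? m ×-dec (ω m ≟ j) ×-dec (ℓ m ≤? n))

product≤^ : ∀ n as → sum as ≤ n → product as ≤ n ^ length as
product≤^ n []       _  = ≤-refl
product≤^ n (a ∷ as) le =
  *-mono-≤ (m+n≤o⇒m≤o a le) (product≤^ n as (m+n≤o⇒n≤o a le))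

admissible-bounded : ∀ {j n m} → Admissible j n m → m ≤ n ^ j
admissible-bounded {n = n} {m} (admissible _ refl le) =
  ≤-trans (≤-reflexive (isFactorisation (factorise m)))
          (product≤^ n (factors (factorise m)) le)

N-factors : ℕ → List ℕ
N-factors zero    = []
N-factors (suc j) = p (suc j) ∷ N-factors j

N-factorisation : ∀ j → PrimeFactorisation (N j)
N-factorisation j = record
  { factors = N-factors j ; isFactorisation = eq j ; factorsPrime = pr j }
  where
  eq : ∀ j → N j ≡ product (N-factors j)
  eq zero    = refl
  eq (suc j) = trans (*-comm (N j) (p (suc j))) (cong (p (suc j) *_) (eq j))

  pr : ∀ j → All Prime (N-factors j)
  pr zero    = []
  pr (suc j) = p-prime j ∷ pr j

N-ω : ∀ j → length (N-factors j) ≡ j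
N-ω zero    = refl
N-ω (suc j) = cong suc (N-ω j)

N-ℓ : ∀ j → sum (N-factors j) ≡ σ j
N-ℓ zero    = refl
N-ℓ (suc j) = trans (+-comm (p (suc j)) _) (cong (_+ p (suc j)) (N-ℓ j))

prime∣prime⇒≡ : ∀ {q r} → Prime q → Prime r → q ∣ r → q ≡ r
prime∣prime⇒≡ pq pr q∣r with prime⇒irreducible pr q∣r
... | inj₁ refl = contradiction pq ¬prime[1]
... | inj₂ q≡r  = q≡r

prime∣N⇒≤ : ∀ {q} j → Prime q → q ∣ N j → q ≤ p j
prime∣N⇒≤ zero    pq q∣1 = contradiction (subst Prime (∣1⇒≡1 q∣1) pq) ¬prime[1]
prime∣N⇒≤ (suc j) pq q∣N with euclidsLemma (N j) (p (suc j)) pq q∣N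
... | inj₁ q∣Nj = ≤-trans (prime∣N⇒≤ j pq q∣Nj) (<⇒≤ (p-< j))
... | inj₂ q∣p  = ≤-reflexive (prime∣prime⇒≡ pq (p-prime j) q∣p)

prime²∤N : ∀ {q} j → Prime q → ¬ (q * q ∣ N j)
prime²∤N {q} zero    pq q²∣1 =
  contradiction (subst Prime (m*n≡1⇒m≡1 q q (∣1⇒≡1 q²∣1)) pq) ¬prime[1]
prime²∤N {q} (suc j) pq q²∣N with q ≟ p (suc j)
... | yes refl = <⇒≱ (p-< j) (prime∣N⇒≤ j pq (*-cancelʳ-∣ q {{prime⇒nonZero pq}} q²∣N))
... | no q≢p with euclidsLemma (N j) (p (suc j)) pq (∣-trans (m∣m*n q) q²∣N)
...   | inj₂ q∣p = q≢p (prime∣prime⇒≡ pq (p-prime j) q∣p)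
...   | inj₁ (divides c Nj≡cq) with euclidsLemma c (p (suc j)) pq q∣cp
  where
  P = p (suc j)
  q∣cp : q ∣ c * P
  q∣cp = *-cancelʳ-∣ q {{prime⇒nonZero pq}} (subst (q * q ∣_) eq q²∣N)
    where
    open ≡-Reasoning
    eq : N j * P ≡ c * P * q
    eq = begin
      N j * P     ≡⟨ cong (_* P) Nj≡cq ⟩
      c * q * P   ≡⟨ *-assoc c q P ⟩
      c * (q * P) ≡⟨ cong (c *_) (*-comm q P) ⟩
      c * (P * q) ≡⟨ *-assoc c P q ⟨
      c * P * q   ∎
...     | inj₁ q∣c = prime²∤N j pq (subst (q * q ∣_) (sym Nj≡cq) (*-monoˡ-∣ q q∣c))
...     | inj₂ q∣p = q≢p (prime∣prime⇒≡ pq (p-prime j) q∣p)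

N-squarefree : ∀ j → Squarefree (N j)
N-squarefree j zero      0∣N =
  contradiction (0∣⇒≡0 0∣N) (≢-nonZero⁻¹ (N j) {{N-nonZero j}})
N-squarefree j d@(suc _) d²∣N with factorise d
... | record { factors = []     ; isFactorisation = eq } = eq
... | record { factors = q ∷ qs ; isFactorisation = eq ; factorsPrime = pq ∷ _ } =
  contradiction (∣-trans (*-pres-∣ q∣d q∣d) d²∣N) (prime²∤N j pq)
  where
  q∣d : q ∣ d
  q∣d = subst (q ∣_) (sym eq) (m∣m*n (product qs))

N-admissible : ∀ j n → σ j ≤ n → Admissible j n (N j)
N-admissible j n σj≤n = record
  { m≢0        = N-nonZero j
  ; squarefree = N-squarefree j
  ; ω≡j        = trans (↭-length perm) (N-ω j)
  ; ℓ≤n        = ≤-trans (≤-reflexive (trans (sum-↭ perm) (N-ℓ j))) σj≤n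
  }
  where
  perm = factorisationUnique (factorise (N j) {{N-nonZero j}}) (N-factorisation j)

h-maximum : ∀ j n → σ j ≤ n → ∃ (IsMaximum (Admissible j n))
h-maximum j n σj≤n =
  maximum (admissible? j n) (n ^ j) admissible-bounded (N j , N-admissible j n σj≤n)

-- The proof argument only witnesses that the set is nonempty; a maximum is
-- unique, so the value does not depend on it.
h : ∀ j n → σ j ≤ n → ℕ
h j n σj≤n = proj₁ (h-maximum j n σj≤n)

<∸⇒∸-nonZero : ∀ {k a} b → k < a ∸ b → NonZero (a ∸ k)
<∸⇒∸-nonZero {k} {a} b k<a∸b = >-nonZero (m<n⇒0<n∸m (<-≤-trans k<a∸b (m∸n≤m a b)))

{-# OPTIONS --safe #-}

-- Put D = P − n'. If q_1 < ⋯ < q_j are the prime factors of h_j(n), then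
-- D + Σ q_i is at most the sum of the j + 1 primes p_{r+1}, …, p_{r+j+1}, and
-- the claim is that D · ∏ q_i is at most their product. Let l be the number of
-- i with q_i ≤ p_{r+i}; they form an initial segment, because the q_i are
-- distinct primes, and q_i ≥ p_{r+i+1} for i > l. Pair D with c = p_{r+l+1},
-- q_i with p_{r+i} for i ≤ l, and q_i with p_{r+i+1} for i > l. In each pair
-- (q , b) with q ≠ D, b lies between q and c, so replacing the q's by their b's
-- one at a time, with D absorbing the change of the sum, never decreases the
-- product, provided that a q below c is replaced only while the current value
-- of D is above c, and vice versa. Once D ≤ c and every q above c is replaced,
-- all remaining replacements only increase the entries.

module Submission where

open import Data.Integer.Base as ℤ using (+_)
import Data.Integer.Properties as ℤ
open import Data.List.Base using (List; []; _∷_; _++_; _∷ʳ_; length; applyUpTo)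
open import Data.List.Properties using (applyUpTo-∷ʳ)
open import Data.List.Relation.Binary.Permutation.Propositional
  using (_↭_; refl; prep; swap; trans; ↭-sym)
open import Data.List.Relation.Binary.Permutation.Propositional.Properties
  using (shift; ↭-length; All-resp-↭)
open import Data.List.Relation.Binary.Pointwise as Pointwise
  using (Pointwise; []; _∷_)
open import Data.List.Relation.Unary.All using (All; []; _∷_)
open import Data.List.Relation.Unary.Linked using (Linked; []; [-]; _∷_; tail)
open import Data.Nat.Base using (ℕ; zero; suc; _+_; _*_; _∸_; _≤_; _<_; z≤n; NonZero)
open import Data.Nat.Divisibility using (∣-trans; m∣m*n; n∣m*n; *-monoʳ-∣)
open import Data.Nat.ListAction using (sum; product)
open import Data.Nat.ListAction.Properties using (sum-++; product-++; sum-↭; product-↭)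
open import Data.Nat.Primality using (Prime; ¬prime[1])
open import Data.Nat.Primality.Factorisation
  using (PrimeFactorisation; factors; factorise)
open import Data.Nat.Properties
open import Data.Nat.Tactic.RingSolver using (solve-∀)
open import Data.Product.Base using (∃; _×_; _,_; proj₁; proj₂)
open import Data.Rational.Base as ℚ using (_/_; toℚᵘ)
open import Data.Rational.Properties
  using (toℚᵘ-fromℚᵘ; toℚᵘ-injective; toℚᵘ-cancel-≤; toℚᵘ-homo-*)
open import Data.Rational.Unnormalised.Base as ℚᵘ using (mkℚᵘ; *≡*; *≤*)
import Data.Rational.Unnormalised.Properties as ℚᵘ
open import Function.Base using (_∘_)
open import Relation.Binary.PropositionalEquality
  using (_≡_; refl; sym; cong; cong₂; subst; module ≡-Reasoning)
  renaming (trans to ≡-trans)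
open import Relation.Nullary.Decidable using (yes; no)
open import Relation.Nullary.Negation using (contradiction)

open import Data.List.Sort ≤-decTotalOrder using (sort; sort-↭; sort-↗)

open import Defs

private
  variable
    b c q x y : ℕ
    qs bs ql qh bl bh : List ℕ

-- Smoothing: products under a bound on the sum

sum-mono-≤ : Pointwise _≤_ qs bs → sum qs ≤ sum bs
sum-mono-≤ = Pointwise.foldr⁺ +-mono-≤ z≤n

product-mono-≤ : Pointwise _≤_ qs bs → product qs ≤ product bs
product-mono-≤ = Pointwise.foldr⁺ *-mono-≤ ≤-refl

sum-∷ʳ : ∀ ms m → sum (ms ∷ʳ m) ≡ sum ms + m
sum-∷ʳ ms m = ≡-trans (sum-++ ms (m ∷ [])) (cong (λ k → sum ms + k) (+-identityʳ m))

product-∷ʳ : ∀ ms m → product (ms ∷ʳ m) ≡ product ms * m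
product-∷ʳ ms m =
  ≡-trans (product-++ ms (m ∷ [])) (cong (λ k → product ms * k) (*-identityʳ m))

Below Above : ℕ → ℕ → ℕ → Set
Below c q b = q ≤ b × b ≤ c
Above c q b = c ≤ b × b ≤ q

-- Moving two numbers towards each other with their sum fixed raises the product: for
-- `y = x + q - b` the gain is `(b - x) * (q - b)`.
smooth : x ≤ b → b ≤ q → ∃ λ y → x + q ≡ y + b × x * q ≤ y * b
smooth {x} {b} x≤b b≤q with m≤n⇒∃[o]m+o≡n b≤q
... | t , refl = x + t , sum-eq x b t , (begin
  x * (b + t)   ≡⟨ *-distribˡ-+ x b t ⟩
  x * b + x * t ≤⟨ +-monoʳ-≤ (x * b) (*-monoˡ-≤ t x≤b) ⟩
  x * b + b * t ≡⟨ product-eq x b t ⟩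
  (x + t) * b   ∎)
  where
  open ≤-Reasoning
  sum-eq : ∀ x b t → x + (b + t) ≡ (x + t) + b
  sum-eq = solve-∀
  product-eq : ∀ x b t → x * b + b * t ≡ (x + t) * b
  product-eq = solve-∀

-- One replacement: `q` becomes `b` and `x` becomes `y`. Then `b` occurs on both sides, so it
-- cancels from the sums and factors out of the products, which leaves the problem `rest` on shorter
-- lists.
swap-out : ∀ x q y b c qs bs → x + q ≡ y + b → x * q ≤ y * b →
           (y + sum qs ≤ c + sum bs → y * product qs ≤ c * product bs) →
           x + sum (q ∷ qs) ≤ c + sum (b ∷ bs) →
           x * product (q ∷ qs) ≤ c * product (b ∷ bs)
swap-out x q y b c qs bs sum≡ product≤ rest le = begin
  x * (q * A) ≡⟨ *-assoc x q A ⟨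
  x * q * A   ≤⟨ *-monoˡ-≤ A product≤ ⟩
  y * b * A   ≡⟨ rotate* y b A ⟩
  b * (y * A) ≤⟨ *-monoʳ-≤ b (rest (+-cancelˡ-≤ b (y + S) (c + T) le′)) ⟩
  b * (c * B) ≡⟨ exchange* b c B ⟩
  c * (b * B) ∎
  where
  S = sum qs
  T = sum bs
  A = product qs
  B = product bs
  open ≤-Reasoning
  rotate* : ∀ y b A → y * b * A ≡ b * (y * A)
  rotate* = solve-∀
  exchange* : ∀ b c B → b * (c * B) ≡ c * (b * B)
  exchange* = solve-∀
  rotate+ : ∀ y b S → b + (y + S) ≡ y + b + S
  rotate+ = solve-∀
  exchange+ : ∀ b c T → c + (b + T) ≡ b + (c + T)
  exchange+ = solve-∀
  le′ : b + (y + S) ≤ b + (c + T)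
  le′ = begin
    b + (y + S) ≡⟨ rotate+ y b S ⟩
    y + b + S   ≡⟨ cong (_+ S) sum≡ ⟨
    x + q + S   ≡⟨ +-assoc x q S ⟩
    x + (q + S) ≤⟨ le ⟩
    c + (b + T) ≡⟨ exchange+ b c T ⟩
    b + (c + T) ∎

-- `x` is the current value of D. Its position relative to `c` decides which of the two lists gives
-- up its first pair, so the recursion ends when the lists run out.
product-≤-by-smoothing :
  ∀ x → Pointwise (Below c) ql bl → Pointwise (Above c) qh bh →
  x + sum (ql ++ qh) ≤ c + sum (bl ++ bh) →
  x * product (ql ++ qh) ≤ c * product (bl ++ bh)
product-≤-by-smoothing {c} x below above le with x ≤? c
product-≤-by-smoothing x below [] le | yes x≤c =
  *-mono-≤ x≤c (product-mono-≤ (Pointwise.++⁺ (Pointwise.map proj₁ below) []))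
product-≤-by-smoothing {c} {ql} {bl} {q ∷ qh} {b ∷ bh} x below ((c≤b , b≤q) ∷ above) le
  | yes x≤c
  with y , sum≡ , product≤ ← smooth (≤-trans x≤c c≤b) b≤q
  -- The pair to be replaced stands in the middle of the concatenations and is first moved to their
  -- front.
  rewrite sum-↭ (shift q ql qh) | product-↭ (shift q ql qh)
        | sum-↭ (shift b bl bh) | product-↭ (shift b bl bh) =
  swap-out x q y b c (ql ++ qh) (bl ++ bh) sum≡ product≤
           (product-≤-by-smoothing y below above) le
-- Impossible: every remaining entry is at least its replacement, so the bound on the sum would
-- force `x ≤ c`.
product-≤-by-smoothing {c} {qh = qh} {bh = bh} x [] above le | no x≰c =
  contradiction (+-cancelʳ-≤ (sum bh) x c (≤-trans (+-monoʳ-≤ x bh≤qh) le)) x≰c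
  where
  bh≤qh : sum bh ≤ sum qh
  bh≤qh = sum-mono-≤ (Pointwise.symmetric proj₂ above)
product-≤-by-smoothing {c} {q ∷ ql} {b ∷ bl} {qh} {bh} x ((q≤b , b≤c) ∷ below) above le | no x≰c
  -- Now `q` is the smaller number and `x` the larger, hence the exchanged roles and the
  -- commutations below.
  with y , sum≡ , product≤ ← smooth q≤b (≤-trans b≤c (≰⇒≥ x≰c)) =
  swap-out x q y b c (ql ++ qh) (bl ++ bh)
           (≡-trans (+-comm x q) sum≡) (≤-trans (≤-reflexive (*-comm x q)) product≤)
           (product-≤-by-smoothing y below above) le

-- Pairing increasing primes with consecutive primes

record Split (c : ℕ) (qs bs : List ℕ) : Set where
  field
    {low high low′ high′} : List ℕ
    qs≡   : qs ≡ low ++ high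
    bs↭   : bs ↭ c ∷ low′ ++ high′
    below : Pointwise (Below c) low low′
    above : Pointwise (Above c) high high′

split⇒product-≤ : Split c qs bs → x + sum qs ≤ sum bs → x * product qs ≤ product bs
split⇒product-≤ {x = x} record { qs≡ = refl ; bs↭ = bs↭ ; below = below ; above = above } le
  rewrite sum-↭ bs↭ | product-↭ bs↭ = product-≤-by-smoothing x below above le

-- A function rather than a list, so that dropping the first prime is composition with `suc`.
record ConsecutivePrimes (b : ℕ → ℕ) : Set where
  field
    mono : ∀ i → b i ≤ b (suc i)
    next : ∀ i {q} → Prime q → b i < q → b (suc i) ≤ q

shifted : ∀ {b} → ConsecutivePrimes b → ConsecutivePrimes (b ∘ suc)
shifted cons = record { mono = mono ∘ suc ; next = next ∘ suc }
  where open ConsecutivePrimes cons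

-- `x` is the entry preceding `qs`. A prime beyond `x` is beyond `b 0`, hence at least `b 1`, and it
-- then serves as the preceding entry for the shifted sequence.
primes-above : ∀ {b} → ConsecutivePrimes b → c ≤ b 0 → b 0 ≤ x →
               All Prime qs → Linked _<_ (x ∷ qs) →
               Pointwise (Above c) qs (applyUpTo (b ∘ suc) (length qs))
primes-above cons c≤b₀ b₀≤x []        _          = []
primes-above cons c≤b₀ b₀≤x (pq ∷ ps) (x<q ∷ qs<) =
  (c≤b₁ , b₁≤q) ∷ primes-above (shifted cons) c≤b₁ b₁≤q ps qs<
  where
  open ConsecutivePrimes cons
  c≤b₁ = ≤-trans c≤b₀ (mono 0)
  b₁≤q = next 0 pq (≤-<-trans b₀≤x x<q)

-- Both sequences are scanned in parallel; `c` is the first `b i` exceeded by its partner, or the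
-- last one if there is none. The bound `b 0 ≤ c` is carried along to make the earlier pairs satisfy
-- `Below c`.
split : ∀ {b} → ConsecutivePrimes b → All Prime qs → Linked _<_ qs →
        ∃ λ c → b 0 ≤ c × Split c qs (applyUpTo b (suc (length qs)))
split {b = b} cons [] _ =
  b 0 , ≤-refl , record { qs≡ = refl ; bs↭ = refl ; below = [] ; above = [] }
split {qs = q ∷ qs} {b} cons (pq ∷ ps) qs< with q ≤? b 0
... | yes q≤b₀ with c , b₁≤c , s ← split (shifted cons) ps (tail qs<) =
  c , b₀≤c , record
    { qs≡   = cong (q ∷_) qs≡
    -- `c` was found further on; it is moved past `b 0`, which joins the low part.
    ; bs↭   = trans (prep (b 0) bs↭) (swap (b 0) c refl)
    ; below = (q≤b₀ , b₀≤c) ∷ below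
    ; above = above
    }
  where
  open Split s
  b₀≤c = ≤-trans (ConsecutivePrimes.mono cons 0) b₁≤c
... | no q≰b₀ =
  b 0 , ≤-refl , record
    { qs≡ = refl ; bs↭ = refl ; below = []
    ; above = primes-above cons ≤-refl ≤-refl (pq ∷ ps) (≰⇒> q≰b₀ ∷ qs<)
    }

-- Sums and products of consecutive primes

window : ℕ → ℕ → List ℕ
window r = applyUpTo (λ i → p (suc (i + r)))

window-consecutive : ∀ r → ConsecutivePrimes (λ i → p (suc (i + r)))
window-consecutive r = record
  { mono = λ i → <⇒≤ (p-< (suc (i + r)))
  ; next = λ i pq lt → proj₂ (proj₂ (nextPrime (p (suc (i + r))))) (pq , lt)
  }

-- The additive form keeps truncated subtraction out of the induction.
sum-window : ∀ r k → sum (window r k) + σ r ≡ σ (k + r)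
sum-window r zero    = refl
sum-window r (suc k) = begin
  sum (window r (suc k)) + σ r  ≡⟨ cong (λ ms → sum ms + σ r) (applyUpTo-∷ʳ _ k) ⟨
  sum (window r k ∷ʳ P) + σ r   ≡⟨ cong (_+ σ r) (sum-∷ʳ (window r k) P) ⟩
  sum (window r k) + P + σ r    ≡⟨ swap-last (sum (window r k)) P (σ r) ⟩
  sum (window r k) + σ r + P    ≡⟨ cong (_+ P) (sum-window r k) ⟩
  σ (k + r) + P                 ∎
  where
  open ≡-Reasoning
  P = p (suc (k + r))
  swap-last : ∀ u v w → u + v + w ≡ u + w + v
  swap-last = solve-∀

p[r+1+k]≡p[1+k+r] : ∀ r k → p (r + suc k) ≡ p (suc (k + r))
p[r+1+k]≡p[1+k+r] r k = cong p (+-comm r (suc k))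

product-window : ∀ r k → product (window r k) ≡ ∏p r k
product-window r zero    = refl
product-window r (suc k) = begin
  product (window r (suc k))             ≡⟨ cong product (applyUpTo-∷ʳ _ k) ⟨
  product (window r k ∷ʳ p (suc (k + r))) ≡⟨ product-∷ʳ (window r k) _ ⟩
  product (window r k) * p (suc (k + r)) ≡⟨ cong₂ _*_ (product-window r k) (sym (p[r+1+k]≡p[1+k+r] r k)) ⟩
  ∏p r k * p (r + suc k)                 ∎
  where open ≡-Reasoning

N*∏p : ∀ r k → N r * ∏p r k ≡ N (k + r)
N*∏p r zero    = *-identityʳ (N r)
N*∏p r (suc k) = begin
  N r * (∏p r k * p (r + suc k)) ≡⟨ *-assoc (N r) (∏p r k) _ ⟨
  N r * ∏p r k * p (r + suc k)   ≡⟨ cong₂ _*_ (N*∏p r k) (p[r+1+k]≡p[1+k+r] r k) ⟩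
  N (k + r) * p (suc (k + r))    ∎
  where open ≡-Reasoning

-- Prime factors of admissible numbers and the integral bound

sorted⇒increasing : All Prime qs → Squarefree (product qs) → Linked _≤_ qs → Linked _<_ qs
sorted⇒increasing _ _ []  = []
sorted⇒increasing _ _ [-] = [-]
sorted⇒increasing {q ∷ q′ ∷ qs} (pq ∷ ps) sf (q≤q′ ∷ qs≤) =
  ≤∧≢⇒< q≤q′ q≢q′
  ∷ sorted⇒increasing ps (λ d d²∣ → sf d (∣-trans d²∣ (n∣m*n q))) qs≤
  where
  q≢q′ : q ≡ q′ → _
  -- Equal neighbours would make `q * q` divide the squarefree product, so `q` would be 1.
  q≢q′ refl = ¬prime[1] (subst Prime (sf q (*-monoʳ-∣ q (m∣m*n (product qs)))) pq)

-- Sorting the factorisation changes neither product, sum nor length, and makes the factors ready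
-- for `split`.
admissible-factors :
  ∀ {j n m} → Admissible j n m →
  ∃ λ qs → All Prime qs × Linked _<_ qs × product qs ≡ m × length qs ≡ j × sum qs ≤ n
admissible-factors {m = m} (admissible sf ω≡j ℓ≤n) =
  sorted , primes , sorted⇒increasing primes (subst Squarefree (sym product≡m) sf) (sort-↗ fs)
     , product≡m , ≡-trans (↭-length perm) ω≡j , ≤-trans (≤-reflexive (sum-↭ perm)) ℓ≤n
  where
  open PrimeFactorisation (factorise m) using (isFactorisation; factorsPrime)
  fs = factors (factorise m)
  sorted = sort fs
  perm : sorted ↭ fs
  perm = sort-↭ fs
  primes : All Prime sorted
  primes = All-resp-↭ (↭-sym perm) factorsPrime
  product≡m : product sorted ≡ m
  product≡m = ≡-trans (product-↭ perm) (sym isFactorisation)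

-- The bound with its denominator `d` cleared: the `j` prime factors leave one of the `suc j` window
-- primes free, and `d` is compared with that one.
h-bound : ∀ j n (σj≤n : σ j ≤ n) r d →
          d + n ≤ sum (window r (suc j)) → d * h j n σj≤n ≤ ∏p r j * p (suc (j + r))
h-bound j n σj≤n r d le
  with qs , primes , qs< , product≡ , refl , sum≤ ←
         admissible-factors (proj₁ (proj₂ (h-maximum j n σj≤n)))
  with _ , _ , s ← split (window-consecutive r) primes qs< = begin
  d * h j n σj≤n             ≡⟨ cong (d *_) product≡ ⟨
  d * product qs             ≤⟨ split⇒product-≤ s (≤-trans (+-monoʳ-≤ d sum≤) le) ⟩
  product (window r (suc j)) ≡⟨ product-window r (suc j) ⟩
  ∏p r j * p (r + suc j)     ≡⟨ cong (∏p r j *_) (p[r+1+k]≡p[1+k+r] r j) ⟩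
  ∏p r j * p (suc (j + r))   ∎
  where open ≤-Reasoning

-- Fractions of natural numbers

toℚᵘ-/ : ∀ i d .{{_ : NonZero d}} → toℚᵘ (i / d) ℚᵘ.≃ i ℚᵘ./ d
toℚᵘ-/ i (suc d) = toℚᵘ-fromℚᵘ (mkℚᵘ i d)

-- Since `_/_` reduces to lowest terms, the identity is checked on unnormalised fractions, by cross
-- multiplication.
ℕ-*-/ : ∀ a m d .{{_ : NonZero d}} → (+ a / 1) ℚ.* (+ m / d) ≡ + (a * m) / d
ℕ-*-/ a m d@(suc _) = toℚᵘ-injective (begin
  toℚᵘ ((+ a / 1) ℚ.* (+ m / d))       ≈⟨ toℚᵘ-homo-* (+ a / 1) (+ m / d) ⟩
  toℚᵘ (+ a / 1) ℚᵘ.* toℚᵘ (+ m / d)   ≈⟨ ℚᵘ.*-cong (toℚᵘ-/ (+ a) 1) (toℚᵘ-/ (+ m) d) ⟩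
  (+ a ℚᵘ./ 1) ℚᵘ.* (+ m ℚᵘ./ d)       ≈⟨ *≡* (cong₂ ℤ._*_ (sym (ℤ.pos-* a m)) (cong +_ (sym (*-identityˡ d)))) ⟩
  + (a * m) ℚᵘ./ d                     ≈⟨ toℚᵘ-/ (+ (a * m)) d ⟨
  toℚᵘ (+ (a * m) / d)                 ∎)
  where open import Relation.Binary.Reasoning.Setoid ℚᵘ.≃-setoid

ℕ-≤-/ : ∀ a m d .{{_ : NonZero d}} → d * a ≤ m → (+ a / 1) ℚ.≤ (+ m / d)
ℕ-≤-/ a m d@(suc _) da≤m = toℚᵘ-cancel-≤ (begin
  toℚᵘ (+ a / 1) ≃⟨ toℚᵘ-/ (+ a) 1 ⟩
  + a ℚᵘ./ 1     ≤⟨ *≤* cross ⟩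
  + m ℚᵘ./ d     ≃⟨ toℚᵘ-/ (+ m) d ⟨
  toℚᵘ (+ m / d) ∎)
  where
  open ℚᵘ.≤-Reasoning
  cross : + a ℤ.* + d ℤ.≤ + m ℤ.* + 1
  cross rewrite sym (ℤ.pos-* a d) | ℤ.*-identityʳ (+ m) | *-comm a d = ℤ.+≤+ da≤m

/-expandˡ : ∀ k m d .{{_ : NonZero d}} .{{_ : NonZero (k * d)}} →
            + m / d ≡ + (k * m) / (k * d)
/-expandˡ k m d = toℚᵘ-injective (begin
  toℚᵘ (+ m / d)              ≈⟨ toℚᵘ-/ (+ m) d ⟩
  + m ℚᵘ./ d                  ≈⟨ expand k m d ⟩
  + (k * m) ℚᵘ./ (k * d)      ≈⟨ toℚᵘ-/ (+ (k * m)) (k * d) ⟨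
  toℚᵘ (+ (k * m) / (k * d))  ∎)
  where
  open import Relation.Binary.Reasoning.Setoid ℚᵘ.≃-setoid
  cross : ∀ k m d → m * (k * d) ≡ k * m * d
  cross = solve-∀
  expand : ∀ k m d .{{_ : NonZero d}} .{{_ : NonZero (k * d)}} →
           + m ℚᵘ./ d ℚᵘ.≃ + (k * m) ℚᵘ./ (k * d)
  expand (suc k) m (suc d) =
    *≡* (≡-trans (sym (ℤ.pos-* m (suc k * suc d)))
        (≡-trans (cong +_ (cross (suc k) m (suc d))) (ℤ.pos-* (suc k * m) (suc d))))

proposition4p1 :
    (j n : ℕ) → 1 ≤ j → (σj≤n : σ j ≤ n) →
    (r : ℕ) → σ (j + r) ∸ σ r ≤ n → n < σ (suc (j + r)) ∸ σ (suc r) →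
    (n' : ℕ) → n' ≡ n ∸ (σ (j + r) ∸ σ r) →
    (n'<gap : n' < p (suc (j + r)) ∸ p (suc r)) →
    let P = p (suc (j + r))
        D = P ∸ n'
        instance
          D≢0 : NonZero D
          D≢0 = <∸⇒∸-nonZero (p (suc r)) n'<gap
          ND≢0 : NonZero (N r * D)
          ND≢0 = m*n≢0 (N r) D {{N-nonZero r}} {{D≢0}}
        bound = (+ ∏p r j / 1) ℚ.* (+ P / D)
    in (+ h j n σj≤n / 1) ℚ.≤ bound × bound ≡ + N (suc (j + r)) / (N r * D)
proposition4p1 j n _ σj≤n r s≤n _ n' n'≡ n'<gap =
    subst ((+ h j n σj≤n / 1) ℚ.≤_) (sym bound≡)
      (ℕ-≤-/ (h j n σj≤n) (∏p r j * P) D {{D≢0}} (h-bound j n σj≤n r D sum≤))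
  , (begin
      (+ ∏p r j / 1) ℚ.* (+ P / D)       ≡⟨ bound≡ ⟩
      + (∏p r j * P) / D                 ≡⟨ /-expandˡ (N r) (∏p r j * P) D ⟩
      + (N r * (∏p r j * P)) / (N r * D) ≡⟨ cong (λ m → + m / (N r * D)) numerator ⟩
      + N (suc (j + r)) / (N r * D)      ∎)
  where
  open ≡-Reasoning
  P = p (suc (j + r))
  D = P ∸ n'
  instance
    D≢0 : NonZero D
    D≢0 = <∸⇒∸-nonZero (p (suc r)) n'<gap
    ND≢0 : NonZero (N r * D)
    ND≢0 = m*n≢0 (N r) D {{N-nonZero r}} {{D≢0}}
  W = sum (window r j)

  bound≡ : (+ ∏p r j / 1) ℚ.* (+ P / D) ≡ + (∏p r j * P) / D
  bound≡ = ℕ-*-/ (∏p r j) P D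

  numerator : N r * (∏p r j * P) ≡ N (suc (j + r))
  numerator = ≡-trans (sym (*-assoc (N r) (∏p r j) P)) (cong (_* P) (N*∏p r j))

  W≡ : σ (j + r) ∸ σ r ≡ W
  W≡ = ≡-trans (cong (_∸ σ r) (sym (sum-window r j))) (m+n∸n≡m W (σ r))

  n≡ : n ≡ n' + W
  n≡ = begin
    n                                         ≡⟨ m∸n+n≡m s≤n ⟨
    n ∸ (σ (j + r) ∸ σ r) + (σ (j + r) ∸ σ r) ≡⟨ cong₂ _+_ (sym n'≡) W≡ ⟩
    n' + W                                    ∎

  n'≤P : n' ≤ P
  n'≤P = ≤-trans (<⇒≤ n'<gap) (m∸n≤m P (p (suc r)))

  -- An equality in fact: `n'` is the excess of `n` over the first `j` window primes, and `D`
  -- completes it to the last prime `P`.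
  sum≤ : D + n ≤ sum (window r (suc j))
  sum≤ = ≤-reflexive (begin
    D + n                  ≡⟨ cong (λ k → D + k) n≡ ⟩
    D + (n' + W)           ≡⟨ +-assoc D n' W ⟨
    D + n' + W             ≡⟨ cong (_+ W) (m∸n+n≡m n'≤P) ⟩
    P + W                  ≡⟨ +-comm P W ⟩
    W + P                  ≡⟨ sum-∷ʳ (window r j) P ⟨
    sum (window r j ∷ʳ P)  ≡⟨ cong sum (applyUpTo-∷ʳ _ j) ⟩
    sum (window r (suc j)) ∎)
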